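{- The category model validates the rules $\mathsf{Hom}$-Elim and $\mathsf{Hom}$-Comp: ($\mathsf{Hom}$-Elim) from $\Gamma\vdash A\,\mathsf{Ty}$; $\Gamma.a:A\vdash X\,\mathsf{Ty}$; $\Gamma.b:A.a:A.^{\mathrm{tw}}f:\mathsf{Hom}_A(\bar a,b).x:X^{\mathrm{op}}\vdash D\,\mathsf{Ty}$; and $\Gamma.a:A.x:X\vdash d:_d D[a/b,\mathsf{refl}_a/f,\bar x/x]$, infer $\Gamma.b:A.a:A.^{\mathrm{tw}}f:\mathsf{Hom}_A(\bar a,b).x:X\vdash j(f,x,d):_d D[\bar x/x]$; ($\mathsf{Hom}$-Comp) under the same premises, $\Gamma.a:A.x:X\vdash j(\mathsf{refl}_a,x,d)\equiv d:_d D[a/b,\mathsf{refl}_a/f,\bar x/x]$. Explicitly: let $\Gamma$ be a category, $A:\Gamma\to\mathbf{Cat}$, $X:\Gamma\diamond A\to\mathbf{Cat}$ and $D:(\Gamma\diamond A^{\to})\diamond X[\mathsf{dom}]^{\mathrm{op}}\to\mathbf{Cat}$ be functors. For every functor $d':\Gamma\diamond A\diamond X\to\Gamma\diamond A^{\to}\diamond (X[\mathsf{dom}]\ltimes D)$ with $\pi_2\circ d'=r$, there is a functor $j:\Gamma\diamond A^{\to}\diamond X[\mathsf{dom}]\to\Gamma\diamond A^{\to}\diamond (X[\mathsf{dom}]\ltimes D)$ with $\pi_2\circ j=\mathrm{id}$ and $j\circ r=d'$.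
   Context: For a strict functor $F:\Gamma\to\mathbf{Cat}$, $\Gamma\diamond F$ is the covariant Grothendieck construction (objects $(\gamma,x)$, $x\in F(\gamma)$; morphisms $(g:\gamma\to\gamma',\ \xi:F(g)x\to x')$), and $F^{\mathrm{op}}:=\mathrm{op}\circ F$. Category model: a context is a category $\Gamma$; a type $\Gamma\vdash A\,\mathsf{Ty}$ is a strict functor $A:\Gamma\to\mathbf{Cat}$; context extension $\Gamma.a:A$ is $\Gamma\diamond A$; a term is a section of the projection $\Gamma\diamond A\to\Gamma$; $A^{\mathrm{op}}$ is $\mathrm{op}\circ A$; $\mathsf{Hom}_A$ in context $\Gamma.b:A.a:A^{\mathrm{op}}$ is $(\gamma,b,a)\mapsto\hom_{A(\gamma)}(a,b)$ (a discrete category). A displayed type $\Gamma\vdash E\,\mathsf{Ty}_d$ is (up to equivalence) an arbitrary functor into $\Gamma$; substitution is pullback; a term $\Gamma\vdash e:_dE$ is a section of that functor. Twisting: for $C:\Gamma\diamond B^{\mathrm{op}}\to\mathbf{Cat}$ (a type $\Gamma.b:B^{\mathrm{op}}\vdash C$), the category $\Gamma\diamond(B\ltimes C)$ has objects $(\gamma,b,c)$ with $c\in C(\gamma,b)$ and morphisms $(g,\beta,\theta):(\gamma,b,c)\to(\gamma',b',c')$ with $g:\gamma\to\gamma'$, $\beta:B(g)b\to b'$, $\theta:C(g,\mathrm{id}_{B(g)b})c\to C(\mathrm{id}_{\gamma'},\beta)c'$. The functor $\pi_2:\Gamma\diamond(B\ltimes C)\to\Gamma\diamond B$ forgetting the last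 component is the displayed type $\Gamma.b:B\vdash C[\bar b/b]\,\mathsf{Ty}_d$ (the twist of $C$), and $\Gamma.b:B.^{\mathrm{tw}}c:C[\bar b/b]$ denotes the context $\Gamma\diamond(B\ltimes C)$. $\mathsf{refl}$: the context $\Gamma.b:A.a:A.^{\mathrm{tw}}f:\mathsf{Hom}_A(\bar a,b)$ is isomorphic to $\Gamma\diamond A^{\to}$, where $A^{\to}:\Gamma\to\mathbf{Cat}$ sends $\gamma$ to the arrow category $A(\gamma)^{\to}$ (with $f$ an arrow $a\to b$ of $A(\gamma)$); $\mathsf{refl}$ is the functor $\Gamma\diamond A\to\Gamma\diamond A^{\to}$, $(\gamma,a)\mapsto(\gamma,\mathrm{id}_a)$. $X[\mathsf{dom}]:\Gamma\diamond A^{\to}\to\mathbf{Cat}$ is $(\gamma,f:a\to b)\mapsto X(\gamma,a)$ (the weakening of $X$), and $r:\Gamma\diamond A\diamond X\to\Gamma\diamond A^{\to}\diamond X[\mathsf{dom}]$ is $(\gamma,a,x)\mapsto(\gamma,\mathrm{id}_a,x)$. The type $D[a/b,\mathsf{refl}_a/f,\bar x/x]$ is the pullback along $r$ of $\pi_2:\Gamma\diamond A^{\to}\diamond (X[\mathsf{dom}]\ltimes D)\to\Gamma\diamond A^{\to}\diamond X[\mathsf{dom}]$; a term $d$ of it is the same as a functor $d'$ with $\pi_2 d'=r$. -}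

module Defs where

open import Level using (Level; _⊔_; suc)
open import Data.Product using (Σ; _,_; proj₁; proj₂)
open import Axiom.UniquenessOfIdentityProofs.WithK using (uip)
open import Relation.Binary.PropositionalEquality
  using (_≡_; refl; sym; trans; cong)

private
  variable
    i o h o₁ h₁ o₂ h₂ o₃ h₃ : Level

-- Objects and morphisms are compared with _≡_, and axiom K is in force, so
-- these are ordinary categories with sets of objects and of morphisms.

record Category (o h : Level) : Set (suc (o ⊔ h)) where
  no-eta-equality
  infixr 9 _∘_
  field
    Obj       : Set o
    Hom       : Obj → Obj → Set h
    id        : ∀ {x} → Hom x x
    _∘_       : ∀ {x y z} → Hom y z → Hom x y → Hom x z
    identityˡ : ∀ {x y} (f : Hom x y) → id ∘ f ≡ f
    identityʳ : ∀ {x y} (f : Hom x y) → f ∘ id ≡ f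
    assoc     : ∀ {w x y z} (f : Hom y z) (g : Hom x y) (k : Hom w x) →
                (f ∘ g) ∘ k ≡ f ∘ (g ∘ k)

  -- Mediates where the laws of a strict functor into Cat identify objects
  -- propositionally but not definitionally.
  ≡⇒Hom : ∀ {x y} → x ≡ y → Hom x y
  ≡⇒Hom refl = id

open Category using (Obj; Hom; id; _∘_; identityˡ; identityʳ; assoc; ≡⇒Hom)

op : Category o h → Category o h
Obj (op C)           = Obj C
Hom (op C) x y       = Hom C y x
id (op C)            = id C
_∘_ (op C) f g       = _∘_ C g f
identityˡ (op C)     = identityʳ C
identityʳ (op C)     = identityˡ C
assoc (op C) f g k   = sym (assoc C k g f)

-- Equality of morphisms whose endpoints are only propositionally equal;
-- it includes equality of the endpoints.

data _[_≅_] (C : Category o h) {x y} (f : Hom C x y) :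
            ∀ {x′ y′} → Hom C x′ y′ → Set (o ⊔ h) where
  refl : C [ f ≅ f ]

module _ {C : Category o h} where
  private module C = Category C

  ≅-sym : ∀ {x y x′ y′} {f : Hom C x y} {g : Hom C x′ y′} →
          C [ f ≅ g ] → C [ g ≅ f ]
  ≅-sym refl = refl

  ≅-trans : ∀ {x y x′ y′ x″ y″}
            {f : Hom C x y} {g : Hom C x′ y′} {k : Hom C x″ y″} →
            C [ f ≅ g ] → C [ g ≅ k ] → C [ f ≅ k ]
  ≅-trans refl q = q

  ≡⇒≅ : ∀ {x y} {f g : Hom C x y} → f ≡ g → C [ f ≅ g ]
  ≡⇒≅ refl = refl

  ≅⇒≡ : ∀ {x y} {f g : Hom C x y} → C [ f ≅ g ] → f ≡ g
  ≅⇒≡ refl = refl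

  ≅-cod : ∀ {x y x′ y′} {f : Hom C x y} {g : Hom C x′ y′} →
          C [ f ≅ g ] → y ≡ y′
  ≅-cod refl = refl

  ∘-cong : ∀ {x y z x′ y′ z′} {f : Hom C y z} {f′ : Hom C y′ z′}
           {g : Hom C x y} {g′ : Hom C x′ y′} →
           C [ f ≅ f′ ] → C [ g ≅ g′ ] → C [ f C.∘ g ≅ f′ C.∘ g′ ]
  ∘-cong refl refl = refl

  id-cong : ∀ {x y} → x ≡ y → C [ C.id {x} ≅ C.id {y} ]
  id-cong refl = refl

  ≡⇒Hom-≅ˡ : ∀ {x y} (p : x ≡ y) → C [ C.≡⇒Hom p ≅ C.id {x} ]
  ≡⇒Hom-≅ˡ refl = refl

  ≡⇒Hom-≅ʳ : ∀ {x y} (p : x ≡ y) → C [ C.≡⇒Hom p ≅ C.id {y} ]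
  ≡⇒Hom-≅ʳ refl = refl

  ∘-≡⇒Hom : ∀ {x y z} (f : Hom C y z) (p : x ≡ y) → C [ f C.∘ C.≡⇒Hom p ≅ f ]
  ∘-≡⇒Hom f refl = ≡⇒≅ (C.identityʳ f)

  ≡⇒Hom-∘ : ∀ {x y z} (p : y ≡ z) (f : Hom C x y) → C [ C.≡⇒Hom p C.∘ f ≅ f ]
  ≡⇒Hom-∘ refl f = ≡⇒≅ (C.identityˡ f)

  op-≅ : ∀ {x y x′ y′} {f : Hom C x y} {g : Hom C x′ y′} →
         C [ f ≅ g ] → op C [ f ≅ g ]
  op-≅ refl = refl

record Functor (C : Category o h) (D : Category o₁ h₁) :
               Set (o ⊔ h ⊔ o₁ ⊔ h₁) where
  no-eta-equality
  private
    module C = Category C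
    module D = Category D
  field
    F₀   : Obj C → Obj D
    F₁   : ∀ {x y} → Hom C x y → Hom D (F₀ x) (F₀ y)
    F-id : ∀ {x} → F₁ (C.id {x}) ≡ D.id
    F-∘  : ∀ {x y z} (f : Hom C y z) (g : Hom C x y) →
           F₁ (f C.∘ g) ≡ F₁ f D.∘ F₁ g

  F₁-cong : ∀ {x y x′ y′} {f : Hom C x y} {g : Hom C x′ y′} →
            C [ f ≅ g ] → D [ F₁ f ≅ F₁ g ]
  F₁-cong refl = refl

  F₁-≡⇒Hom : ∀ {x y} (p : x ≡ y) → D [ F₁ (C.≡⇒Hom p) ≅ D.id {F₀ x} ]
  F₁-≡⇒Hom refl = ≡⇒≅ F-id

open Functor using (F₀; F₁; F-id; F-∘)

idF : {C : Category o h} → Functor C C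
F₀ idF x     = x
F₁ idF f     = f
F-id idF     = refl
F-∘ idF _ _  = refl

infixr 9 _∘F_

_∘F_ : {C : Category o h} {D : Category o₁ h₁} {E : Category o₂ h₂} →
       Functor D E → Functor C D → Functor C E
F₀ (G ∘F F) x    = F₀ G (F₀ F x)
F₁ (G ∘F F) f    = F₁ G (F₁ F f)
F-id (G ∘F F)    = trans (cong (F₁ G) (F-id F)) (F-id G)
F-∘ (G ∘F F) f g = trans (cong (F₁ G) (F-∘ F f g)) (F-∘ G (F₁ F f) (F₁ F g))

opF : {C : Category o h} {D : Category o₁ h₁} →
      Functor C D → Functor (op C) (op D)
F₀ (opF F)      = F₀ F
F₁ (opF F)      = F₁ F
F-id (opF F)    = F-id F
F-∘ (opF F) f g = F-∘ F g f

-- Strict equality of functors (not natural isomorphism), stated pointwise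
-- because function extensionality is not available.

infix 4 _≈_

record _≈_ {C : Category o h} {D : Category o₁ h₁} (F G : Functor C D) :
           Set (o ⊔ h ⊔ o₁ ⊔ h₁) where
  field
    eq₀ : ∀ x → F₀ F x ≡ F₀ G x
    eq₁ : ∀ {x y} (f : Hom C x y) → D [ F₁ F f ≅ F₁ G f ]

open _≈_ using (eq₀; eq₁)

record CatFunctor (Γ : Category o h) (o₁ h₁ : Level) :
                  Set (o ⊔ h ⊔ suc (o₁ ⊔ h₁)) where
  no-eta-equality
  private module Γ = Category Γ
  field
    Fib     : Obj Γ → Category o₁ h₁
    map     : ∀ {x y} → Hom Γ x y → Functor (Fib x) (Fib y)
    map-id  : ∀ {x} → map (Γ.id {x}) ≈ idF
    map-∘   : ∀ {x y z} (f : Hom Γ y z) (g : Hom Γ x y) →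
              map (f Γ.∘ g) ≈ map f ∘F map g

  act : ∀ {x y} → Hom Γ x y → Obj (Fib x) → Obj (Fib y)
  act f = F₀ (map f)

  -- A commuting square acts by equal composites on objects.
  act-square : ∀ {w x y z} {f : Hom Γ x z} {g : Hom Γ w x}
               {f′ : Hom Γ y z} {g′ : Hom Γ w y} →
               f Γ.∘ g ≡ f′ Γ.∘ g′ → ∀ c → act f (act g c) ≡ act f′ (act g′ c)
  act-square {f = f} {g} {f′} {g′} p c =
    trans (sym (eq₀ (map-∘ f g) c))
          (trans (cong (λ k → act k c) p) (eq₀ (map-∘ f′ g′) c))

  act-triangle : ∀ {w x z} {f : Hom Γ x z} {g : Hom Γ w x} {k : Hom Γ w z} →
                 f Γ.∘ g ≡ k → ∀ c → act f (act g c) ≡ act k c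
  act-triangle {f = f} {g} p c =
    trans (sym (eq₀ (map-∘ f g) c)) (cong (λ k → act k c) p)

open CatFunctor using (Fib; map; map-id; map-∘; act; act-square; act-triangle)

infix 25 _^op

_^op : {Γ : Category o h} → CatFunctor Γ o₁ h₁ → CatFunctor Γ o₁ h₁
Fib (F ^op) γ            = op (Fib F γ)
map (F ^op) g            = opF (map F g)
eq₀ (map-id (F ^op))     = eq₀ (map-id F)
eq₁ (map-id (F ^op)) f   = op-≅ (eq₁ (map-id F) f)
eq₀ (map-∘ (F ^op) g k)   = eq₀ (map-∘ F g k)
eq₁ (map-∘ (F ^op) g k) f = op-≅ (eq₁ (map-∘ F g k) f)

map-≈ : {Γ : Category o h} (F : CatFunctor Γ o₁ h₁) →
        ∀ {x y} {f g : Hom Γ x y} {G : Functor (Fib F x) (Fib F y)} →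
        f ≡ g → map F g ≈ G → map F f ≈ G
map-≈ F refl e = e

infixl 25 _[_]

_[_] : {Γ : Category o h} {Δ : Category o₁ h₁} →
       CatFunctor Γ o₂ h₂ → Functor Δ Γ → CatFunctor Δ o₂ h₂
Fib (F [ σ ]) δ     = Fib F (F₀ σ δ)
map (F [ σ ]) g     = map F (F₁ σ g)
map-id (F [ σ ])    = map-≈ F (F-id σ) (map-id F)
map-∘ (F [ σ ]) f g = map-≈ F (F-∘ σ f g) (map-∘ F (F₁ σ f) (F₁ σ g))

module _ {Γ : Category o h} (F : CatFunctor Γ o₁ h₁) where
  private
    module Γ = Category Γ
    module Fibre {γ} = Category (Fib F γ)

  record ◇Hom (p q : Σ (Obj Γ) (λ γ → Obj (Fib F γ))) : Set (h ⊔ h₁) where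
    constructor _,_
    field
      base  : Hom Γ (proj₁ p) (proj₁ q)
      fibre : Hom (Fib F (proj₁ q)) (act F base (proj₂ p)) (proj₂ q)

  ◇-≡ : ∀ {p q} {k l : ◇Hom p q} → ◇Hom.base k ≡ ◇Hom.base l →
        Fib F (proj₁ q) [ ◇Hom.fibre k ≅ ◇Hom.fibre l ] → k ≡ l
  ◇-≡ refl refl = refl

  private
    ◇id : ∀ {p} → ◇Hom p p
    ◇id = Γ.id , Fibre.≡⇒Hom (eq₀ (map-id F) _)

    _◇∘_ : ∀ {p q r} → ◇Hom q r → ◇Hom p q → ◇Hom p r
    (g′ , ξ′) ◇∘ (g , ξ) =
      (g′ Γ.∘ g) ,
      (ξ′ Fibre.∘ F₁ (map F g′) ξ Fibre.∘ Fibre.≡⇒Hom (eq₀ (map-∘ F g′ g) _))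

  ◇∘-fibre : ∀ {p q r} (k : ◇Hom q r) (l : ◇Hom p q) →
             Fib F (proj₁ r)
               [ ◇Hom.fibre (k ◇∘ l)
               ≅ ◇Hom.fibre k Fibre.∘ F₁ (map F (◇Hom.base k)) (◇Hom.fibre l) ]
  ◇∘-fibre (g′ , ξ′) (g , ξ) =
    ∘-cong refl (∘-≡⇒Hom (F₁ (map F g′) ξ) (eq₀ (map-∘ F g′ g) _))

  private
    ◇idˡ : ∀ {p q} (k : ◇Hom p q) → ◇id ◇∘ k ≡ k
    ◇idˡ (g , ξ) = ◇-≡ (Γ.identityˡ g)
      (≅-trans (◇∘-fibre ◇id (g , ξ))
      (≅-trans (≡⇒Hom-∘ (eq₀ (map-id F) _) _) (eq₁ (map-id F) ξ)))

    ◇idʳ : ∀ {p q} (k : ◇Hom p q) → k ◇∘ ◇id ≡ k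
    ◇idʳ (g , ξ) = ◇-≡ (Γ.identityʳ g)
      (≅-trans (◇∘-fibre (g , ξ) ◇id)
      (≅-trans (∘-cong refl (≅-trans (Functor.F₁-≡⇒Hom (map F g) (eq₀ (map-id F) _))
                                     (id-cong (cong (act F g) (eq₀ (map-id F) _)))))
               (≡⇒≅ (Fibre.identityʳ ξ))))

    ◇assoc : ∀ {p q r s} (k : ◇Hom r s) (l : ◇Hom q r) (m : ◇Hom p q) →
             (k ◇∘ l) ◇∘ m ≡ k ◇∘ (l ◇∘ m)
    ◇assoc k@(g , ξ) l@(g′ , ξ′) m@(g″ , ξ″) = ◇-≡ (Γ.assoc g g′ g″)
      (≅-trans (◇∘-fibre (k ◇∘ l) m)
      (≅-trans (∘-cong (◇∘-fibre k l) (eq₁ (map-∘ F g g′) ξ″))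
      (≅-trans (≡⇒≅ (Fibre.assoc _ _ _))
      (≅-sym
      (≅-trans (◇∘-fibre k (l ◇∘ m))
               (∘-cong refl
                 (≅-trans (Functor.F₁-cong (map F g) (◇∘-fibre l m))
                          (≡⇒≅ (F-∘ (map F g) _ _)))))))))

  ◇-category : Category (o ⊔ o₁) (h ⊔ h₁)
  Obj ◇-category       = Σ (Obj Γ) (λ γ → Obj (Fib F γ))
  Hom ◇-category       = ◇Hom
  id ◇-category        = ◇id
  _∘_ ◇-category       = _◇∘_
  identityˡ ◇-category = ◇idˡ
  identityʳ ◇-category = ◇idʳ
  assoc ◇-category     = ◇assoc

  ◇-≅ : ∀ {p q q′} {k : ◇Hom p q} {l : ◇Hom p (proj₁ q , q′)} →
        ◇Hom.base k ≡ ◇Hom.base l →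
        Fib F (proj₁ q) [ ◇Hom.fibre k ≅ ◇Hom.fibre l ] → ◇-category [ k ≅ l ]
  ◇-≅ refl refl = refl

  cocartesian : ∀ {γ γ′} (g : Hom Γ γ γ′) (x : Obj (Fib F γ)) →
                ◇Hom (γ , x) (γ′ , act F g x)
  cocartesian g x = g , Fibre.id

  vertical : ∀ {γ x x′} → Hom (Fib F γ) x x′ → ◇Hom (γ , x) (γ , x′)
  vertical ξ = Γ.id , (ξ Fibre.∘ Fibre.≡⇒Hom (eq₀ (map-id F) _))

  vertical-fibre : ∀ {γ x x′} (ξ : Hom (Fib F γ) x x′) →
                   Fib F γ [ ◇Hom.fibre (vertical ξ) ≅ ξ ]
  vertical-fibre ξ = ∘-≡⇒Hom ξ (eq₀ (map-id F) _)

  vertical-∘ : ∀ {γ x y z}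
               (ξ′ : Hom (Fib F γ) y z) (ξ : Hom (Fib F γ) x y) →
               vertical ξ′ ◇∘ vertical ξ ≡ vertical (ξ′ Fibre.∘ ξ)
  vertical-∘ ξ′ ξ = ◇-≡ (Γ.identityˡ Γ.id)
    (≅-trans (◇∘-fibre (vertical ξ′) (vertical ξ))
    (≅-trans (∘-cong (vertical-fibre ξ′)
                     (≅-trans (eq₁ (map-id F) _) (vertical-fibre ξ)))
             (≅-sym (vertical-fibre (ξ′ Fibre.∘ ξ)))))

open ◇Hom using (base; fibre)

infixl 20 _◇_

_◇_ : (Γ : Category o h) → CatFunctor Γ o₁ h₁ → Category (o ⊔ o₁) (h ⊔ h₁)
Γ ◇ F = ◇-category F

-- Equality of morphisms lying in fibres over indices that are only
-- propositionally equal.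

data _⟦_≅_⟧ {I : Set i} (𝒞 : I → Category o h) {j x y} (f : Hom (𝒞 j) x y) :
            ∀ {j′ x′ y′} → Hom (𝒞 j′) x′ y′ → Set (i ⊔ o ⊔ h) where
  refl : 𝒞 ⟦ f ≅ f ⟧

module _ {I : Set i} {𝒞 : I → Category o h} where
  private module 𝒞 {j} = Category (𝒞 j)

  ⟦sym⟧ : ∀ {j x y j′ x′ y′} {f : Hom (𝒞 j) x y} {g : Hom (𝒞 j′) x′ y′} →
          𝒞 ⟦ f ≅ g ⟧ → 𝒞 ⟦ g ≅ f ⟧
  ⟦sym⟧ refl = refl

  ⟦trans⟧ : ∀ {j x y j′ x′ y′ j″ x″ y″} {f : Hom (𝒞 j) x y}
            {g : Hom (𝒞 j′) x′ y′} {k : Hom (𝒞 j″) x″ y″} →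
            𝒞 ⟦ f ≅ g ⟧ → 𝒞 ⟦ g ≅ k ⟧ → 𝒞 ⟦ f ≅ k ⟧
  ⟦trans⟧ refl q = q

  ⟦_⟧ : ∀ {j x y x′ y′} {f : Hom (𝒞 j) x y} {g : Hom (𝒞 j) x′ y′} →
        𝒞 j [ f ≅ g ] → 𝒞 ⟦ f ≅ g ⟧
  ⟦ refl ⟧ = refl

  glue-cong : ∀ {j w x y z j′ w′ x′ y′ z′}
              {f : Hom (𝒞 j) y z} {f′ : Hom (𝒞 j′) y′ z′}
              {g : Hom (𝒞 j) w x} {g′ : Hom (𝒞 j′) w′ x′}
              (p : x ≡ y) (p′ : x′ ≡ y′) →
              𝒞 ⟦ f ≅ f′ ⟧ → 𝒞 ⟦ g ≅ g′ ⟧ →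
              𝒞 ⟦ f 𝒞.∘ 𝒞.≡⇒Hom p 𝒞.∘ g ≅ f′ 𝒞.∘ 𝒞.≡⇒Hom p′ 𝒞.∘ g′ ⟧
  glue-cong refl refl refl refl = refl

  glue-idˡ : ∀ {j w x y z} (q : y ≡ z) (p : x ≡ y) (g : Hom (𝒞 j) w x) →
             𝒞 ⟦ 𝒞.≡⇒Hom q 𝒞.∘ 𝒞.≡⇒Hom p 𝒞.∘ g ≅ g ⟧
  glue-idˡ q p g = ⟦ ≅-trans (≡⇒Hom-∘ q _) (≡⇒Hom-∘ p g) ⟧

  glue-idʳ : ∀ {j w x y z} (f : Hom (𝒞 j) y z) (p : x ≡ y) (q : w ≡ x) →
             𝒞 ⟦ f 𝒞.∘ 𝒞.≡⇒Hom p 𝒞.∘ 𝒞.≡⇒Hom q ≅ f ⟧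
  glue-idʳ f p refl = ⟦ ≅-trans (∘-cong refl (≡⇒≅ (𝒞.identityʳ _))) (∘-≡⇒Hom f p) ⟧

  glue-assoc : ∀ {j u v w x y z} (f : Hom (𝒞 j) y z) (p : x ≡ y)
               (g : Hom (𝒞 j) w x) (q : v ≡ w) (k : Hom (𝒞 j) u v) →
               (f 𝒞.∘ 𝒞.≡⇒Hom p 𝒞.∘ g) 𝒞.∘ 𝒞.≡⇒Hom q 𝒞.∘ k
               ≡ f 𝒞.∘ 𝒞.≡⇒Hom p 𝒞.∘ (g 𝒞.∘ 𝒞.≡⇒Hom q 𝒞.∘ k)
  glue-assoc f p g q k =
    trans (𝒞.assoc f _ _) (cong (f 𝒞.∘_) (𝒞.assoc (𝒞.≡⇒Hom p) g _))

glue-map : {C : Category o h} {D : Category o₁ h₁} (F : Functor C D) →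
           let module C = Category C
               module D = Category D in
           ∀ {w x y z} (f : Hom C y z) (p : x ≡ y) (g : Hom C w x) →
           F₁ F (f C.∘ C.≡⇒Hom p C.∘ g)
           ≡ F₁ F f D.∘ D.≡⇒Hom (cong (F₀ F) p) D.∘ F₁ F g
glue-map {C = C} {D} F f refl g =
  trans (F-∘ F f _)
        (cong (F₁ F f D.∘_)
              (trans (F-∘ F C.id g)
                     (cong (D._∘ F₁ F g) (F-id F))))
  where
  module C = Category C
  module D = Category D

map-≡⇒Hom : {C : Category o h} {D : Category o₁ h₁} (F : Functor C D) →
            ∀ {x y} (p : x ≡ y) →
            F₁ F (Category.≡⇒Hom C p) ≡ Category.≡⇒Hom D (cong (F₀ F) p)
map-≡⇒Hom F refl = F-id F

module _ {Γ : Category o h} (C : CatFunctor Γ o₁ h₁) where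
  private module Γ = Category Γ

  map-cong : ∀ {x y y′ u v u′ v′} {m : Hom Γ x y} {m′ : Hom Γ x y′}
             {θ : Hom (Fib C x) u v} {θ′ : Hom (Fib C x) u′ v′} →
             Γ [ m ≅ m′ ] → Fib C ⟦ θ ≅ θ′ ⟧ →
             Fib C ⟦ F₁ (map C m) θ ≅ F₁ (map C m′) θ′ ⟧
  map-cong refl refl = refl

  -- C(m)C(k) agrees with C(m′)C(k′) on morphisms when m ∘ k ≅ m′ ∘ k′.
  map-square : ∀ {w x x′ y y′} {m : Hom Γ x y} {k : Hom Γ w x}
               {m′ : Hom Γ x′ y′} {k′ : Hom Γ w x′} →
               Γ [ m Γ.∘ k ≅ m′ Γ.∘ k′ ] →
               ∀ {u v} (θ : Hom (Fib C w) u v) →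
               Fib C ⟦ F₁ (map C m) (F₁ (map C k) θ)
                     ≅ F₁ (map C m′) (F₁ (map C k′) θ) ⟧
  map-square {m = m} {k} {m′} {k′} p θ =
    ⟦trans⟧ (⟦sym⟧ ⟦ eq₁ (map-∘ C m k) θ ⟧)
    (⟦trans⟧ (map-cong p refl) ⟦ eq₁ (map-∘ C m′ k′) θ ⟧)

  map-triangle : ∀ {w x y y′} {m : Hom Γ x y} {k : Hom Γ w x}
                 {n : Hom Γ w y′} → Γ [ m Γ.∘ k ≅ n ] →
                 ∀ {u v} (θ : Hom (Fib C w) u v) →
                 Fib C ⟦ F₁ (map C m) (F₁ (map C k) θ) ≅ F₁ (map C n) θ ⟧
  map-triangle {m = m} {k} p θ =
    ⟦trans⟧ (⟦sym⟧ ⟦ eq₁ (map-∘ C m k) θ ⟧) (map-cong p refl)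

  map-unit : ∀ {x y} {m : Hom Γ x y} → Γ [ m ≅ Γ.id {x} ] →
             ∀ {u v} (θ : Hom (Fib C x) u v) → Fib C ⟦ F₁ (map C m) θ ≅ θ ⟧
  map-unit p θ = ⟦trans⟧ (map-cong p refl) ⟦ eq₁ (map-id C) θ ⟧

module _ {Γ : Category o h} (B : CatFunctor Γ o₁ h₁)
         (C : CatFunctor (Γ ◇ B ^op) o₂ h₂) where
  private
    Γᴮ = Γ ◇ B
    Γᵒ = Γ ◇ B ^op
    module Γ = Category Γ
    module Γᴮ = Category Γᴮ
    module Γᵒ = Category Γᵒ
    module Bf {γ} = Category (Fib B γ)
    module Cf {s} = Category (Fib C s)

  -- A morphism a = (g , β) : (γ , b) → (γ′ , b′) of Γ ◇ B gives a cospan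
  --
  --             lower a                 upper a
  --   (γ , b) ----------> (γ′ , B(g)b) <---------- (γ′ , b′)
  --            (g , id)                  (id , β)
  --
  -- in Γ ◇ B ^op.

  apex : ∀ {s t} → Hom Γᴮ s t → Obj Γᵒ
  apex {s} {t} a = proj₁ t , act B (base a) (proj₂ s)

  lower : ∀ {s t} (a : Hom Γᴮ s t) → Hom Γᵒ s (apex a)
  lower {s} a = cocartesian (B ^op) (base a) (proj₂ s)

  upper : ∀ {s t} (a : Hom Γᴮ s t) → Hom Γᵒ t (apex a)
  upper a = vertical (B ^op) (fibre a)

  record ⋉Hom (p q : Σ (Obj Γᴮ) (λ s → Obj (Fib C s))) :
              Set (h ⊔ h₁ ⊔ h₂) where
    constructor _,_
    field
      under : Hom Γᴮ (proj₁ p) (proj₁ q)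
      over  : Hom (Fib C (apex under)) (act C (lower under) (proj₂ p))
                                       (act C (upper under) (proj₂ q))

  ⋉-≡ : ∀ {p q} {k l : ⋉Hom p q} → ⋉Hom.under k ≡ ⋉Hom.under l →
        Fib C ⟦ ⋉Hom.over k ≅ ⋉Hom.over l ⟧ → k ≡ l
  ⋉-≡ refl refl = refl

  -- The cospan of a composite a′ ∘ a is obtained from those of a and a′:
  --
  --     left a′ a  : apex a  → apex (a′ ∘ a)
  --     right a′ a : apex a′ → apex (a′ ∘ a)

  left : ∀ {s t u} (a′ : Hom Γᴮ t u) (a : Hom Γᴮ s t) →
         Hom Γᵒ (apex a) (apex (a′ Γᴮ.∘ a))
  left a′ a = base a′ , Bf.≡⇒Hom (eq₀ (map-∘ B (base a′) (base a)) _)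

  right : ∀ {s t u} (a′ : Hom Γᴮ t u) (a : Hom Γᴮ s t) →
          Hom Γᵒ (apex a′) (apex (a′ Γᴮ.∘ a))
  right a′ a = vertical (B ^op)
    (F₁ (map B (base a′)) (fibre a)
      Bf.∘ Bf.≡⇒Hom (eq₀ (map-∘ B (base a′) (base a)) _))

  left-fibre : ∀ {s t u} (a′ : Hom Γᴮ t u) (a : Hom Γᴮ s t) →
               op (Fib B (proj₁ u)) [ fibre (left a′ a)
                 ≅ Bf.id {x = act B (base a′) (act B (base a) (proj₂ s))} ]
  left-fibre a′ a = op-≅ (≡⇒Hom-≅ʳ (eq₀ (map-∘ B (base a′) (base a)) _))

  right-fibre : ∀ {s t u} (a′ : Hom Γᴮ t u) (a : Hom Γᴮ s t) →
                op (Fib B (proj₁ u)) [ fibre (right a′ a)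
                                     ≅ F₁ (map B (base a′)) (fibre a) ]
  right-fibre a′ a =
    ≅-trans (vertical-fibre (B ^op) _) (op-≅ (∘-≡⇒Hom _ (eq₀ (map-∘ B _ _) _)))

  left-lower : ∀ {s t u} (a′ : Hom Γᴮ t u) (a : Hom Γᴮ s t) →
               left a′ a Γᵒ.∘ lower a ≡ lower (a′ Γᴮ.∘ a)
  left-lower a′ a = ◇-≡ (B ^op) refl
    (≅-trans (◇∘-fibre (B ^op) (left a′ a) (lower a))
    (≅-trans (∘-cong refl (≡⇒≅ (F-id (map (B ^op) (base a′)))))
    (≅-trans (op-≅ (≡⇒≅ (Bf.identityˡ _)))
             (op-≅ (≡⇒Hom-≅ˡ (eq₀ (map-∘ B (base a′) (base a)) _))))))

  right-upper : ∀ {s t u} (a′ : Hom Γᴮ t u) (a : Hom Γᴮ s t) →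
                right a′ a Γᵒ.∘ upper a′ ≡ upper (a′ Γᴮ.∘ a)
  right-upper a′ a = vertical-∘ (B ^op) _ (fibre a′)

  left-upper : ∀ {s t u} (a′ : Hom Γᴮ t u) (a : Hom Γᴮ s t) →
               left a′ a Γᵒ.∘ upper a ≡ right a′ a Γᵒ.∘ lower a′
  left-upper a′ a =
    ◇-≡ (B ^op) (trans (Γ.identityʳ (base a′)) (sym (Γ.identityˡ (base a′))))
    (≅-trans (◇∘-fibre (B ^op) (left a′ a) (upper a))
    (≅-trans (∘-cong (left-fibre a′ a)
               (Functor.F₁-cong (map (B ^op) (base a′))
                                (vertical-fibre (B ^op) (fibre a))))
    (≅-trans (op-≅ (≡⇒≅ (Bf.identityʳ _)))
    (≅-sym
    (≅-trans (◇∘-fibre (B ^op) (right a′ a) (lower a′))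
    (≅-trans (∘-cong (right-fibre a′ a) (eq₁ (map-id (B ^op)) _))
             (op-≅ (≡⇒≅ (Bf.identityˡ _)))))))))

  lower-upper-id : ∀ {s} → lower (Γᴮ.id {s}) ≡ upper (Γᴮ.id {s})
  lower-upper-id {s} = ◇-≡ (B ^op) refl
    (≅-sym (≅-trans (vertical-fibre (B ^op) _)
                    (op-≅ (≡⇒Hom-≅ˡ (eq₀ (map-id B) (proj₂ s))))))

  lower-upper-act : ∀ {s} (c : Obj (Fib C s)) →
                    act C (lower Γᴮ.id) c ≡ act C (upper Γᴮ.id) c
  lower-upper-act c = cong (λ k → act C k c) lower-upper-id

  ⋉id : ∀ {p} → ⋉Hom p p
  ⋉id {_ , c} = Γᴮ.id , Cf.≡⇒Hom (lower-upper-act c)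

  middle : ∀ {s t u} (a′ : Hom Γᴮ t u) (a : Hom Γᴮ s t) (c : Obj (Fib C t)) →
           act C (left a′ a) (act C (upper a) c)
           ≡ act C (right a′ a) (act C (lower a′) c)
  middle a′ a = act-square C (left-upper a′ a)

  -- C(left)θ followed by C(right)θ′, up to the identifications of objects
  -- given by left-lower, left-upper and right-upper.
  _⋉∘_ : ∀ {p q r} → ⋉Hom q r → ⋉Hom p q → ⋉Hom p r
  _⋉∘_ {_ , c} {_ , c′} {_ , c″} (a′ , θ′) (a , θ) =
    (a′ Γᴮ.∘ a) ,
    (Cf.≡⇒Hom (act-triangle C (right-upper a′ a) c″)
      Cf.∘ (F₁ (map C (right a′ a)) θ′
             Cf.∘ Cf.≡⇒Hom (middle a′ a c′)
             Cf.∘ F₁ (map C (left a′ a)) θ)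
      Cf.∘ Cf.≡⇒Hom (sym (act-triangle C (left-lower a′ a) c)))

  ⋉∘-over : ∀ {p q r} (k : ⋉Hom q r) (l : ⋉Hom p q) →
            let a′ = ⋉Hom.under k
                a  = ⋉Hom.under l in
            Fib C ⟦ ⋉Hom.over (k ⋉∘ l)
                  ≅ F₁ (map C (right a′ a)) (⋉Hom.over k)
                      Cf.∘ Cf.≡⇒Hom (middle a′ a (proj₂ q))
                      Cf.∘ F₁ (map C (left a′ a)) (⋉Hom.over l) ⟧
  ⋉∘-over {_ , c} {_ , c′} {_ , c″} (a′ , θ′) (a , θ) =
    ⟦ ≅-trans (≡⇒Hom-∘ (act-triangle C (right-upper a′ a) c″) _)
              (∘-≡⇒Hom _ (sym (act-triangle C (left-lower a′ a) c))) ⟧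

  -- The identity of Γᵒ at apex a has fibre component an identity of B.
  id-fibre : ∀ {s} → op (Fib B (proj₁ s)) [ fibre (Γᵒ.id {s}) ≅ Bf.id {x = proj₂ s} ]
  id-fibre {s} = ≡⇒Hom-≅ʳ {C = op (Fib B (proj₁ s))} (eq₀ (map-id (B ^op)) (proj₂ s))

  left-idˡ : ∀ {s t} (a : Hom Γᴮ s t) → Γᵒ [ left Γᴮ.id a ≅ Γᵒ.id {apex a} ]
  left-idˡ {s} {t} a = ◇-≅ (B ^op) refl
    (≅-trans (left-fibre Γᴮ.id a)
    (≅-trans (id-cong (eq₀ (map-id (B ^op)) (act B (base a) (proj₂ s))))
             (≅-sym (id-fibre {apex a}))))

  right-idʳ : ∀ {s t} (a : Hom Γᴮ s t) → Γᵒ [ right a Γᴮ.id ≅ Γᵒ.id {apex a} ]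
  right-idʳ {s} a = ◇-≅ (B ^op) refl
    (≅-trans (right-fibre a Γᴮ.id)
    (≅-trans (op-≅ (≅-trans
               (Functor.F₁-cong (map B (base a)) (≡⇒Hom-≅ʳ (eq₀ (map-id B) (proj₂ s))))
               (≡⇒≅ (F-id (map B (base a))))))
             (≅-sym (id-fibre {apex a}))))

  ⋉idˡ : ∀ {p q} (k : ⋉Hom p q) → ⋉id ⋉∘ k ≡ k
  ⋉idˡ {_} {_ , c} k@(a , θ) = ⋉-≡ (Γᴮ.identityˡ a)
    (⟦trans⟧ (⋉∘-over ⋉id k)
    (⟦trans⟧ (glue-cong (middle Γᴮ.id a c) (middle Γᴮ.id a c)
               ⟦ ≡⇒≅ (map-≡⇒Hom (map C (right Γᴮ.id a)) (lower-upper-act c)) ⟧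
               refl)
    (⟦trans⟧ (glue-idˡ (cong (act C (right Γᴮ.id a)) (lower-upper-act c))
                       (middle Γᴮ.id a c) _)
             (map-unit C (left-idˡ a) θ))))

  ⋉idʳ : ∀ {p q} (k : ⋉Hom p q) → k ⋉∘ ⋉id ≡ k
  ⋉idʳ {_ , c} k@(a , θ) = ⋉-≡ (Γᴮ.identityʳ a)
    (⟦trans⟧ (⋉∘-over k ⋉id)
    (⟦trans⟧ (glue-cong (middle a Γᴮ.id c) (middle a Γᴮ.id c)
               refl
               ⟦ ≡⇒≅ (map-≡⇒Hom (map C (left a Γᴮ.id)) (lower-upper-act c)) ⟧)
    (⟦trans⟧ (glue-idʳ _ (middle a Γᴮ.id c)
                       (cong (act C (left a Γᴮ.id)) (lower-upper-act c)))
             (map-unit C (right-idʳ a) θ))))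

  module _ {s t u v} (a″ : Hom Γᴮ u v) (a′ : Hom Γᴮ t u) (a : Hom Γᴮ s t) where

    left-left : Γᵒ [ left a″ (a′ Γᴮ.∘ a) Γᵒ.∘ left a′ a
                   ≅ left (a″ Γᴮ.∘ a′) a ]
    left-left = ◇-≅ (B ^op) refl
      (≅-trans (◇∘-fibre (B ^op) (left a″ (a′ Γᴮ.∘ a)) (left a′ a))
      (≅-trans (∘-cong (left-fibre a″ (a′ Γᴮ.∘ a)) (Functor.F₁-cong (map (B ^op) (base a″))
                 (op-≅ (≡⇒Hom-≅ˡ (eq₀ (map-∘ B (base a′) (base a)) _)))))
      (≅-trans (∘-cong refl (≡⇒≅ (F-id (map (B ^op) (base a″)))))
      (≅-trans (op-≅ (≡⇒≅ (Bf.identityˡ _)))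
      (≅-sym (≅-trans (left-fibre (a″ Γᴮ.∘ a′) a)
        (id-cong (trans (eq₀ (map-∘ B (base a″) (base a′)) _)
          (cong (act B (base a″)) (sym (eq₀ (map-∘ B (base a′) (base a)) _)))))))))))

    right-right : Γᵒ [ right (a″ Γᴮ.∘ a′) a Γᵒ.∘ right a″ a′
                     ≅ right a″ (a′ Γᴮ.∘ a) ]
    right-right = ◇-≅ (B ^op) (Γ.identityˡ Γ.id)
      (≅-trans (◇∘-fibre (B ^op) (right (a″ Γᴮ.∘ a′) a) (right a″ a′))
      (≅-trans (∘-cong
                 (≅-trans (right-fibre (a″ Γᴮ.∘ a′) a)
                          (op-≅ (eq₁ (map-∘ B (base a″) (base a′)) (fibre a))))
                 (≅-trans (eq₁ (map-id (B ^op)) _) (right-fibre a″ a′)))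
      (≅-sym
      (≅-trans (right-fibre a″ (a′ Γᴮ.∘ a))
      (op-≅ (≅-trans (Functor.F₁-cong (map B (base a″)) (◇∘-fibre B a′ a))
                     (≡⇒≅ (F-∘ (map B (base a″)) _ _))))))))

    right-left : Γᵒ [ right (a″ Γᴮ.∘ a′) a Γᵒ.∘ left a″ a′
                    ≅ left a″ (a′ Γᴮ.∘ a) Γᵒ.∘ right a′ a ]
    right-left = ◇-≅ (B ^op) (trans (Γ.identityˡ _) (sym (Γ.identityʳ _)))
      (≅-trans (◇∘-fibre (B ^op) (right (a″ Γᴮ.∘ a′) a) (left a″ a′))
      (≅-trans (∘-cong (right-fibre (a″ Γᴮ.∘ a′) a)
                 (≅-trans (eq₁ (map-id (B ^op)) _)
                          (op-≅ (≡⇒Hom-≅ˡ (eq₀ (map-∘ B (base a″) (base a′)) _)))))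
      (≅-trans (op-≅ (≡⇒≅ (Bf.identityˡ _)))
      (≅-trans (op-≅ (eq₁ (map-∘ B (base a″) (base a′)) (fibre a)))
      (≅-sym
      (≅-trans (◇∘-fibre (B ^op) (left a″ (a′ Γᴮ.∘ a)) (right a′ a))
      (≅-trans (∘-cong
                 (≅-trans (left-fibre a″ (a′ Γᴮ.∘ a))
                   (id-cong (cong (act B (base a″))
                                  (eq₀ (map-∘ B (base a′) (base a)) _))))
                 (Functor.F₁-cong (map (B ^op) (base a″)) (right-fibre a′ a)))
               (op-≅ (≡⇒≅ (Bf.identityʳ _))))))))))

  ⋉assoc : ∀ {p q r z} (k : ⋉Hom r z) (l : ⋉Hom q r) (m : ⋉Hom p q) →
           (k ⋉∘ l) ⋉∘ m ≡ k ⋉∘ (l ⋉∘ m)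
  ⋉assoc {_} {_ , c′} {_ , c″} k@(a″ , θ″) l@(a′ , θ′) m@(a , θ) =
    ⋉-≡ (Γᴮ.assoc a″ a′ a)
    (⟦trans⟧ (⋉∘-over (k ⋉∘ l) m)
    (⟦trans⟧ (glue-cong (middle (a″ Γᴮ.∘ a′) a c′) p₁
               (⟦trans⟧ (map-cong C refl (⋉∘-over k l))
                        ⟦ ≡⇒≅ (glue-map (map C R₁) _ (middle a″ a′ c″) _) ⟧)
               refl)
    (⟦trans⟧ ⟦ ≡⇒≅ (glue-assoc {𝒞 = Fib C} _ p₂ _ p₁ _) ⟧
    (⟦trans⟧ (glue-cong p₂ p₃ (map-triangle C (right-right a″ a′ a) θ″)
               (glue-cong p₁ p₄ (map-square C (right-left a″ a′ a) θ′)
                 (⟦sym⟧ (map-triangle C (left-left a″ a′ a) θ))))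
    (⟦sym⟧
    (⟦trans⟧ (⋉∘-over k (l ⋉∘ m))
             (glue-cong (middle a″ (a′ Γᴮ.∘ a) c″) p₃ refl
               (⟦trans⟧ (map-cong C refl (⋉∘-over l m))
                        ⟦ ≡⇒≅ (glue-map (map C L₁) _ (middle a′ a c′) _) ⟧))))))))
    where
    R₁ = right (a″ Γᴮ.∘ a′) a
    L₁ = left a″ (a′ Γᴮ.∘ a)
    p₁ = trans (middle (a″ Γᴮ.∘ a′) a c′)
               (cong (act C R₁) (sym (act-triangle C (left-lower a″ a′) c′)))
    p₂ = cong (act C R₁) (middle a″ a′ c″)
    p₃ = trans (cong (act C L₁) (act-triangle C (right-upper a′ a) c″))
               (middle a″ (a′ Γᴮ.∘ a) c″)
    p₄ = cong (act C L₁) (middle a′ a c′)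

  ⋉-category : Category (o ⊔ o₁ ⊔ o₂) (h ⊔ h₁ ⊔ h₂)
  Obj ⋉-category       = Σ (Obj Γᴮ) (λ s → Obj (Fib C s))
  Hom ⋉-category       = ⋉Hom
  id ⋉-category        = ⋉id
  _∘_ ⋉-category       = _⋉∘_
  identityˡ ⋉-category = ⋉idˡ
  identityʳ ⋉-category = ⋉idʳ
  assoc ⋉-category     = ⋉assoc

open ⋉Hom using (under; over)

infix 20 _◇⟨_⋉_⟩

_◇⟨_⋉_⟩ : (Γ : Category o h) (B : CatFunctor Γ o₁ h₁) →
          CatFunctor (Γ ◇ B ^op) o₂ h₂ →
          Category (o ⊔ o₁ ⊔ o₂) (h ⊔ h₁ ⊔ h₂)
Γ ◇⟨ B ⋉ C ⟩ = ⋉-category B C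

π₂ : {Γ : Category o h} {B : CatFunctor Γ o₁ h₁}
     {C : CatFunctor (Γ ◇ B ^op) o₂ h₂} → Functor (Γ ◇⟨ B ⋉ C ⟩) (Γ ◇ B)
F₀ π₂ (s , _)  = s
F₁ π₂ (a , _)  = a
F-id π₂        = refl
F-∘ π₂ _ _     = refl

record ArrowObj (C : Category o h) : Set (o ⊔ h) where
  constructor arrow
  field
    {source target} : Obj C
    arr             : Hom C source target

open ArrowObj

module _ (C : Category o h) where
  private module C = Category C

  record Square (f g : ArrowObj C) : Set h where
    constructor square
    field
      top     : Hom C (source f) (source g)
      bottom  : Hom C (target f) (target g)
      commute : bottom C.∘ arr f ≡ arr g C.∘ top

  arrow-≡ : ∀ {x y x′ y′} {f : Hom C x y} {g : Hom C x′ y′} →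
            C [ f ≅ g ] → arrow {C = C} f ≡ arrow g
  arrow-≡ refl = refl

  square-≡ : ∀ {f g} {s t : Square f g} → Square.top s ≡ Square.top t →
             Square.bottom s ≡ Square.bottom t → s ≡ t
  square-≡ {s = square α β p} {square _ _ q} refl refl =
    cong (square α β) (uip p q)

  Arrow : Category (o ⊔ h) h
  Obj Arrow = ArrowObj C
  Hom Arrow = Square
  id Arrow  = square C.id C.id (trans (C.identityˡ _) (sym (C.identityʳ _)))
  _∘_ Arrow {f} {g} {k} (square α′ β′ p′) (square α β p) =
    square (α′ C.∘ α) (β′ C.∘ β)
      (trans (C.assoc β′ β (arr f))
      (trans (cong (β′ C.∘_) p)
      (trans (sym (C.assoc β′ (arr g) α))
      (trans (cong (C._∘ α) p′)
             (C.assoc (arr k) α′ α)))))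
  identityˡ Arrow _ = square-≡ (C.identityˡ _) (C.identityˡ _)
  identityʳ Arrow _ = square-≡ (C.identityʳ _) (C.identityʳ _)
  assoc Arrow _ _ _ = square-≡ (C.assoc _ _ _) (C.assoc _ _ _)

  square-≅ : ∀ {f g f′ g′} {s : Square f g} {t : Square f′ g′} →
             f ≡ f′ → g ≡ g′ →
             C [ Square.top s ≅ Square.top t ] →
             C [ Square.bottom s ≅ Square.bottom t ] → Arrow [ s ≅ t ]
  square-≅ refl refl p q = ≡⇒≅ (square-≡ (≅⇒≡ p) (≅⇒≡ q))

open Square using (top; bottom; commute)

mapArrow : {C : Category o h} {D : Category o₁ h₁} →
           Functor C D → Functor (Arrow C) (Arrow D)
F₀ (mapArrow F) f = arrow (F₁ F (arr f))
F₁ (mapArrow F) {f} {g} (square α β p) =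
  square (F₁ F α) (F₁ F β)
    (trans (sym (F-∘ F β (arr f))) (trans (cong (F₁ F) p) (F-∘ F (arr g) α)))
F-id (mapArrow {D = D} F)    = square-≡ D (F-id F) (F-id F)
F-∘ (mapArrow {D = D} F) _ _ = square-≡ D (F-∘ F _ _) (F-∘ F _ _)

infix 25 _^→

_^→ : {Γ : Category o h} → CatFunctor Γ o₁ h₁ → CatFunctor Γ (o₁ ⊔ h₁) h₁
Fib (A ^→) γ                    = Arrow (Fib A γ)
map (A ^→) g                    = mapArrow (map A g)
eq₀ (map-id (A ^→) {γ}) f       = arrow-≡ (Fib A γ) (eq₁ (map-id A) (arr f))
eq₁ (map-id (A ^→) {γ}) {f} {g} s =
  square-≅ (Fib A γ)
    (arrow-≡ (Fib A γ) (eq₁ (map-id A) (arr f)))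
    (arrow-≡ (Fib A γ) (eq₁ (map-id A) (arr g)))
    (eq₁ (map-id A) (top s))
    (eq₁ (map-id A) (bottom s))
eq₀ (map-∘ (A ^→) {z = γ} k l) f = arrow-≡ (Fib A γ) (eq₁ (map-∘ A k l) (arr f))
eq₁ (map-∘ (A ^→) {z = γ} k l) {f} {g} s =
  square-≅ (Fib A γ)
    (arrow-≡ (Fib A γ) (eq₁ (map-∘ A k l) (arr f)))
    (arrow-≡ (Fib A γ) (eq₁ (map-∘ A k l) (arr g)))
    (eq₁ (map-∘ A k l) (top s))
    (eq₁ (map-∘ A k l) (bottom s))

module _ {Γ : Category o h} (A : CatFunctor Γ o₁ h₁) where

  source-≡⇒Hom : ∀ {γ} {f g : ArrowObj (Fib A γ)} (p : f ≡ g) →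
    Fib A γ [ top (≡⇒Hom (Arrow (Fib A γ)) p) ≅ id (Fib A γ) {source g} ]
  source-≡⇒Hom refl = refl

  target-≡⇒Hom : ∀ {γ} {f g : ArrowObj (Fib A γ)} (p : f ≡ g) →
    Fib A γ [ bottom (≡⇒Hom (Arrow (Fib A γ)) p) ≅ id (Fib A γ) {target g} ]
  target-≡⇒Hom refl = refl

  dom : Functor (Γ ◇ A ^→) (Γ ◇ A)
  F₀ dom (γ , f)    = γ , source f
  F₁ dom (g , σ)    = g , top σ
  F-id dom {_ , f}  = ◇-≡ A refl
    (≅-trans (source-≡⇒Hom (eq₀ (map-id (A ^→)) f))
             (≅-sym (≡⇒Hom-≅ʳ (eq₀ (map-id A) (source f)))))
  F-∘ dom {_ , f} (g′ , _) (g , _) = ◇-≡ A refl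
    (∘-cong refl (∘-cong refl
      (≅-trans (source-≡⇒Hom (eq₀ (map-∘ (A ^→) g′ g) f))
               (≅-sym (≡⇒Hom-≅ʳ (eq₀ (map-∘ A g′ g) (source f)))))))

  -- The functor refl, (γ , a) ↦ (γ , id_a); renamed because of _≡_'s refl.
  reflexivity : Functor (Γ ◇ A) (Γ ◇ A ^→)
  F₀ reflexivity (γ , a) = γ , arrow (id (Fib A γ) {a})
  F₁ reflexivity {_} {γ′ , _} (g , α) = g , square α α
    (trans (cong (_∘_ (Fib A γ′) α) (F-id (map A g)))
           (trans (identityʳ (Fib A γ′) α) (sym (identityˡ (Fib A γ′) α))))
  F-id reflexivity {γ , a} = ◇-≡ (A ^→) refl (≡⇒≅ (square-≡ (Fib A γ)
    (≅⇒≡ (≅-trans (≡⇒Hom-≅ʳ p) (≅-sym (source-≡⇒Hom q))))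
    (≅⇒≡ (≅-trans (≡⇒Hom-≅ʳ p) (≅-sym (target-≡⇒Hom q))))))
    where
    p = eq₀ (map-id A) a
    q = eq₀ (map-id (A ^→)) (arrow (id (Fib A γ) {a}))
  F-∘ reflexivity {γ , a} {_} {γ″ , _} (g′ , _) (g , _) =
    ◇-≡ (A ^→) refl (≡⇒≅ (square-≡ (Fib A γ″)
      (≅⇒≡ (∘-cong refl (∘-cong refl
        (≅-trans (≡⇒Hom-≅ʳ p) (≅-sym (source-≡⇒Hom q))))))
      (≅⇒≡ (∘-cong refl (∘-cong refl
        (≅-trans (≡⇒Hom-≅ʳ p) (≅-sym (target-≡⇒Hom q))))))))
    where
    p = eq₀ (map-∘ A g′ g) a
    q = eq₀ (map-∘ (A ^→) g′ g) (arrow (id (Fib A γ) {a}))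

  module _ (X : CatFunctor (Γ ◇ A) o₂ h₂) where

    r : Functor (Γ ◇ A ◇ X) (Γ ◇ A ^→ ◇ X [ dom ])
    F₀ r (s , x)   = F₀ reflexivity s , x
    F₁ r (k , ξ)   = F₁ reflexivity k , ξ
    F-id r {_ , x} = ◇-≡ (X [ dom ]) (F-id reflexivity)
      (≅-trans (≡⇒Hom-≅ʳ (eq₀ (map-id X) x))
               (≅-sym (≡⇒Hom-≅ʳ (eq₀ (map-id (X [ dom ])) x))))
    F-∘ r {_ , x} (k′ , _) (k , _) =
      ◇-≡ (X [ dom ]) (F-∘ reflexivity k′ k)
      (∘-cong refl (∘-cong refl
        (≅-trans (≡⇒Hom-≅ʳ (eq₀ (map-∘ X k′ k) x))
                 (≅-sym (≡⇒Hom-≅ʳ (eq₀ (map-∘ (X [ dom ]) l′ l) x))))))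
      where
      l′ = F₁ reflexivity k′
      l  = F₁ reflexivity k

{-# OPTIONS --safe #-}
module Submission where

-- Every f : a → b receives the square (id_a , f) : id_a → f, natural in f and
-- sent to an identity by dom.  So j (γ , f , x) is obtained by transporting
-- d (γ , a , x) along D of this square, and a morphism of Γ ◇ A^→ ◇ X[dom] acts
-- by the value of d on its image in Γ ◇ A ◇ X, transported along D of the square
-- at the apex of its cospan.  Over an identity arrow the square is an identity,
-- which gives j ∘ r = d′.

open import Defs
open import Level using (Level; _⊔_)
open import Data.Product using (Σ; Σ-syntax; _×_; _,_; proj₁; proj₂)
open import Relation.Binary.PropositionalEquality
  using (_≡_; refl; sym; trans; cong)

open Category using (Obj; Hom)
open Functor using (F₀; F₁; F-id; F-∘)
open CatFunctor using (Fib; map; map-id; map-∘; act; act-square)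
open _≈_ using (eq₀; eq₁)
open ◇Hom using (base; fibre)
open ⋉Hom using (under; over)
open Square using (top; commute)

private
  variable
    o h o₁ h₁ o₂ h₂ o₃ h₃ : Level

-- Coercions between propositionally equal objects.

module _ {C : Category o h} where
  private module C = Category C

  absorb-≡⇒Hom : ∀ {w x y z w′} (f : Hom C y z) (p : x ≡ y)
                 {g : Hom C w x} {g′ : Hom C w′ y} →
                 C [ g ≅ g′ ] → C [ (f C.∘ C.≡⇒Hom p) C.∘ g ≅ f C.∘ g′ ]
  absorb-≡⇒Hom f p {g} e =
    ≅-trans (≡⇒≅ (C.assoc f _ g)) (∘-cong refl (≅-trans (≡⇒Hom-∘ p g) e))

  conjugate-≅ : ∀ {w x y z} (p : y ≡ z) (f : Hom C x y) (q : w ≡ x) →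
                C [ C.≡⇒Hom p C.∘ f C.∘ C.≡⇒Hom q ≅ f ]
  conjugate-≅ p f q = ≅-trans (≡⇒Hom-∘ p _) (∘-≡⇒Hom f q)

  ∘-≡⇒Hom-id : ∀ {x y z} {f : Hom C y z} (p : x ≡ y) →
               C [ f ≅ C.id {y} ] → C [ f C.∘ C.≡⇒Hom p ≅ C.id {x} ]
  ∘-≡⇒Hom-id {f = f} p e = ≅-trans (∘-≡⇒Hom f p) (≅-trans e (id-cong (sym p)))

  -- A record rather than a synonym: conversion checking would otherwise unfold
  -- the composites of the Grothendieck constructions.
  record CommutesOver {u v w x y z} (p : u ≡ v) (l : Hom C x u) (f : Hom C v w)
                      (e : Hom C x y) (l′ : Hom C y z) : Set (o ⊔ h) where
    constructor commutes
    field
      commuting : C [ (f C.∘ C.≡⇒Hom p) C.∘ l ≅ l′ C.∘ e ]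

  replace-square : ∀ {u v w v′ w′ x y z} {f : Hom C v w} {f′ : Hom C v′ w′} {p : u ≡ v}
                   {l : Hom C x u} {g : Hom C x v′} {e : Hom C x y}
                   {l′ : Hom C y z} {g′ : Hom C y w′} →
                   C [ f ≅ f′ ] → C [ l ≅ g ] → C [ l′ ≅ g′ ] →
                   f′ C.∘ g ≡ g′ C.∘ e → CommutesOver p l f e l′
  replace-square {f = f} {p = p} ef el el′ s = commutes
    (≅-trans (∘-cong (≅-trans (∘-≡⇒Hom f p) ef) el)
    (≅-trans (≡⇒≅ s) (∘-cong (≅-sym el′) refl)))

open CommutesOver using (commuting)

-- Coercions are identities up to `≅`, so only their objects matter. These lie in fibres over
-- possibly different indices and are therefore compared as pairs.
≡⇒Hom-⟦≅⟧ : {I : Set o₂} {𝒞 : I → Category o h} →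
            ∀ {i j} {x y : Obj (𝒞 i)} {x′ y′ : Obj (𝒞 j)}
            (p : x ≡ y) (p′ : x′ ≡ y′) →
            _≡_ {A = Σ I (λ k → Obj (𝒞 k))} (i , x) (j , x′) →
            𝒞 ⟦ Category.≡⇒Hom (𝒞 i) p ≅ Category.≡⇒Hom (𝒞 j) p′ ⟧
≡⇒Hom-⟦≅⟧ refl refl refl = refl

map-cong-≅ : {Γ : Category o h} (C : CatFunctor Γ o₁ h₁) →
             ∀ {x y x′ y′ u v u′ v′} {m : Hom Γ x y} {m′ : Hom Γ x′ y′}
             {θ : Hom (Fib C x) u v} {θ′ : Hom (Fib C x′) u′ v′} →
             Γ [ m ≅ m′ ] → Fib C ⟦ θ ≅ θ′ ⟧ →
             Fib C ⟦ F₁ (map C m) θ ≅ F₁ (map C m′) θ′ ⟧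
map-cong-≅ C refl refl = refl

act-≅ : {Γ : Category o h} (C : CatFunctor Γ o₁ h₁) →
        ∀ {s t t′} {k : Hom Γ s t} {k′ : Hom Γ s t′} →
        Γ [ k ≅ k′ ] → ∀ c →
        _≡_ {A = Σ (Obj Γ) (λ u → Obj (Fib C u))} (t , act C k c) (t′ , act C k′ c)
act-≅ C refl c = refl

act-≅-id : {Γ : Category o h} (C : CatFunctor Γ o₁ h₁) →
           ∀ {s t} {k : Hom Γ s t} → Γ [ k ≅ Category.id Γ {s} ] → ∀ c →
           _≡_ {A = Σ (Obj Γ) (λ u → Obj (Fib C u))} (t , act C k c) (s , c)
act-≅-id C {s} refl c = cong (s ,_) (eq₀ (map-id C) c)

act-square-≅ : {Γ : Category o h} (C : CatFunctor Γ o₁ h₁) →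
               ∀ {w x y z z′} {f : Hom Γ x z} {g : Hom Γ w x}
               {f′ : Hom Γ y z′} {g′ : Hom Γ w y} →
               Γ [ Category._∘_ Γ f g ≅ Category._∘_ Γ f′ g′ ] → ∀ c →
               _≡_ {A = Σ (Obj Γ) (λ u → Obj (Fib C u))}
                   (z , act C f (act C g c)) (z′ , act C f′ (act C g′ c))
act-square-≅ C {z = z} {z′} {f} {g} {f′} {g′} e c =
  trans (cong (z ,_) (sym (eq₀ (map-∘ C f g) c)))
  (trans (act-≅ C e c) (cong (z′ ,_) (eq₀ (map-∘ C f′ g′) c)))

-- Cospans underlying the morphisms of a twist.

module _ {Γ : Category o h} (B : CatFunctor Γ o₁ h₁)
         (C : CatFunctor (Γ ◇ B ^op) o₂ h₂) where
  private
    Γᴮ = Γ ◇ B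
    Γᵒ = Γ ◇ B ^op
    module Γᵒ = Category Γᵒ
    module Γᴮ = Category Γᴮ
    module Cf {s} = Category (Fib C s)

  ⋉-≅ : ∀ {p q p′ q′} {k : ⋉Hom B C p q} {l : ⋉Hom B C p′ q′} →
        p ≡ p′ → q ≡ q′ → Γᴮ [ under k ≅ under l ] →
        Fib C ⟦ over k ≅ over l ⟧ → (Γ ◇⟨ B ⋉ C ⟩) [ k ≅ l ]
  ⋉-≅ refl refl e e′ = ≡⇒≅ (⋉-≡ B C (≅⇒≡ e) e′)

  over-cong : ∀ {p q} {k l : ⋉Hom B C p q} → k ≡ l → Fib C ⟦ over k ≅ over l ⟧
  over-cong refl = refl

  apex-cong : ∀ {s t s′ t′} {a : Hom Γᴮ s t} {a′ : Hom Γᴮ s′ t′} →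
              Γᴮ [ a ≅ a′ ] → apex B C a ≡ apex B C a′
  apex-cong refl = refl

  lower-cong : ∀ {s t s′ t′} {a : Hom Γᴮ s t} {a′ : Hom Γᴮ s′ t′} →
               Γᴮ [ a ≅ a′ ] → Γᵒ [ lower B C a ≅ lower B C a′ ]
  lower-cong refl = refl

  upper-cong : ∀ {s t s′ t′} {a : Hom Γᴮ s t} {a′ : Hom Γᴮ s′ t′} →
               Γᴮ [ a ≅ a′ ] → Γᵒ [ upper B C a ≅ upper B C a′ ]
  upper-cong refl = refl

  left-cong : ∀ {s t u s′ t′ u′} {a : Hom Γᴮ t u} {a′ : Hom Γᴮ t′ u′}
              {b : Hom Γᴮ s t} {b′ : Hom Γᴮ s′ t′} →
              Γᴮ [ a ≅ a′ ] → Γᴮ [ b ≅ b′ ] → Γᵒ [ left B C a b ≅ left B C a′ b′ ]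
  left-cong refl refl = refl

  right-cong : ∀ {s t u s′ t′ u′} {a : Hom Γᴮ t u} {a′ : Hom Γᴮ t′ u′}
               {b : Hom Γᴮ s t} {b′ : Hom Γᴮ s′ t′} →
               Γᴮ [ a ≅ a′ ] → Γᴮ [ b ≅ b′ ] → Γᵒ [ right B C a b ≅ right B C a′ b′ ]
  right-cong refl refl = refl

  -- `left` and `right` contain coercions for the functoriality of `B`. Without these they are a
  -- cocartesian and a vertical morphism, the two kinds for which naturality is proved later.
  left-≅-cocartesian : ∀ {s t u} (a′ : Hom Γᴮ t u) (a : Hom Γᴮ s t) →
    Γᵒ [ left B C a′ a ≅ cocartesian (B ^op) (base a′) (act B (base a) (proj₂ s)) ]
  left-≅-cocartesian a′ a = ◇-≅ (B ^op) refl (left-fibre B C a′ a)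

  right-≅-vertical : ∀ {s t u} (a′ : Hom Γᴮ t u) (a : Hom Γᴮ s t) →
    Γᵒ [ right B C a′ a ≅ vertical (B ^op) (F₁ (map B (base a′)) (fibre a)) ]
  right-≅-vertical {s} a′ a =
    vertical-cong (op-≅ (∘-≡⇒Hom _ (eq₀ (map-∘ B (base a′) (base a)) (proj₂ s))))
    where
    vertical-cong : ∀ {γ x y x′ y′} {ξ : Hom (op (Fib B γ)) x y}
                    {ξ′ : Hom (op (Fib B γ)) x′ y′} → op (Fib B γ) [ ξ ≅ ξ′ ] →
                    Γᵒ [ vertical (B ^op) {γ} ξ ≅ vertical (B ^op) {γ} ξ′ ]
    vertical-cong refl = refl

  module _ {Z : Category o₃ h₃} where
    private module Z = Category Z

    apex-∘ : ∀ (S : Functor Z Γᴮ) {x y z} (m′ : Hom Z y z) (m : Hom Z x y) →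
             apex B C (F₁ S m′ Γᴮ.∘ F₁ S m) ≡ apex B C (F₁ S (m′ Z.∘ m))
    apex-∘ S m′ m = cong (apex B C) (sym (F-∘ S m′ m))

    -- S and T land in Γ ◇ B but the components S z → T z lie in Γ ◇ B ^op, so
    -- naturality at m can only be stated on the cospans of S m and T m.
    -- The path p in the last two laws absorbs the functoriality of S.
    record CospanMap (S T : Functor Z Γᴮ) : Set (o ⊔ h ⊔ o₁ ⊔ h₁ ⊔ o₃ ⊔ h₃) where
      field
        at      : ∀ z → Hom Γᵒ (F₀ S z) (F₀ T z)
        at-apex : ∀ {z z′} (m : Hom Z z z′) →
                  Hom Γᵒ (apex B C (F₁ S m)) (apex B C (F₁ T m))
        at-lower : ∀ {z z′} (m : Hom Z z z′) →
                   at-apex m Γᵒ.∘ lower B C (F₁ S m) ≡ lower B C (F₁ T m) Γᵒ.∘ at z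
        at-upper : ∀ {z z′} (m : Hom Z z z′) →
                   at-apex m Γᵒ.∘ upper B C (F₁ S m) ≡ upper B C (F₁ T m) Γᵒ.∘ at z′
        at-left  : ∀ {x y z} (m′ : Hom Z y z) (m : Hom Z x y)
                   (p : apex B C (F₁ S m′ Γᴮ.∘ F₁ S m) ≡ apex B C (F₁ S (m′ Z.∘ m))) →
                   CommutesOver {C = Γᵒ} p
                     (left B C (F₁ S m′) (F₁ S m)) (at-apex (m′ Z.∘ m))
                     (at-apex m) (left B C (F₁ T m′) (F₁ T m))
        at-right : ∀ {x y z} (m′ : Hom Z y z) (m : Hom Z x y)
                   (p : apex B C (F₁ S m′ Γᴮ.∘ F₁ S m) ≡ apex B C (F₁ S (m′ Z.∘ m))) →
                   CommutesOver {C = Γᵒ} p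
                     (right B C (F₁ S m′) (F₁ S m)) (at-apex (m′ Z.∘ m))
                     (at-apex m′) (right B C (F₁ T m′) (F₁ T m))

    open CospanMap

    opaque
      -- Needed because `π₂ ∘F d′` agrees with `r` only propositionally. Components change by
      -- coercions alone, so each law reduces to that of `M`. The definition can stay opaque:
      -- besides the laws, only the two identity criteria below are used.
      precompose : ∀ {S S′ T} → S′ ≈ S → CospanMap S T → CospanMap S′ T
      at (precompose e M) z = at M z Γᵒ.∘ Γᵒ.≡⇒Hom (eq₀ e z)
      at-apex (precompose e M) m = at-apex M m Γᵒ.∘ Γᵒ.≡⇒Hom (apex-cong (eq₁ e m))
      at-lower (precompose e M) m = ≅⇒≡
        (≅-trans (absorb-≡⇒Hom (at-apex M m) (apex-cong (eq₁ e m)) (lower-cong (eq₁ e m)))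
        (≅-trans (≡⇒≅ (at-lower M m))
                 (∘-cong refl (≅-sym (∘-≡⇒Hom (at M _) (eq₀ e _))))))
      at-upper (precompose e M) m = ≅⇒≡
        (≅-trans (absorb-≡⇒Hom (at-apex M m) (apex-cong (eq₁ e m)) (upper-cong (eq₁ e m)))
        (≅-trans (≡⇒≅ (at-upper M m))
                 (∘-cong refl (≅-sym (∘-≡⇒Hom (at M _) (eq₀ e _))))))
      at-left (precompose {S} e M) m′ m p = commutes
        (≅-trans (≡⇒≅ (Γᵒ.assoc _ _ _))
        -- The path `p`, which concerns `S′`, is traded for `apex-∘ S m′ m`, which concerns `S`, so
        -- that the law of `M` applies.
        (≅-trans (absorb-≡⇒Hom (at-apex M (m′ Z.∘ m)) (apex-cong (eq₁ e (m′ Z.∘ m)))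
                   (≅-trans (≡⇒Hom-∘ p _)
                   (≅-trans (left-cong (eq₁ e m′) (eq₁ e m)) (≅-sym (≡⇒Hom-∘ (apex-∘ S m′ m) _)))))
        (≅-trans (≡⇒≅ (sym (Γᵒ.assoc _ _ _)))
        (≅-trans (commuting (at-left M m′ m (apex-∘ S m′ m)))
                 (∘-cong refl (≅-sym (∘-≡⇒Hom (at-apex M m) (apex-cong (eq₁ e m)))))))))
      at-right (precompose {S} e M) m′ m p = commutes
        (≅-trans (≡⇒≅ (Γᵒ.assoc _ _ _))
        (≅-trans (absorb-≡⇒Hom (at-apex M (m′ Z.∘ m)) (apex-cong (eq₁ e (m′ Z.∘ m)))
                   (≅-trans (≡⇒Hom-∘ p _)
                   (≅-trans (right-cong (eq₁ e m′) (eq₁ e m)) (≅-sym (≡⇒Hom-∘ (apex-∘ S m′ m) _)))))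
        (≅-trans (≡⇒≅ (sym (Γᵒ.assoc _ _ _)))
        (≅-trans (commuting (at-right M m′ m (apex-∘ S m′ m)))
                 (∘-cong refl (≅-sym (∘-≡⇒Hom (at-apex M m′) (apex-cong (eq₁ e m′)))))))))

      precompose-at : ∀ {S S′ T} (e : S′ ≈ S) (M : CospanMap S T) {z} →
                      Γᵒ [ at M z ≅ Γᵒ.id {F₀ S z} ] →
                      Γᵒ [ at (precompose e M) z ≅ Γᵒ.id {F₀ S′ z} ]
      precompose-at e M {z} = ∘-≡⇒Hom-id {C = Γᵒ} (eq₀ e z)

      precompose-at-apex : ∀ {S S′ T} (e : S′ ≈ S) (M : CospanMap S T)
                           {z z′} {m : Hom Z z z′} →
                           Γᵒ [ at-apex M m ≅ Γᵒ.id {apex B C (F₁ S m)} ] →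
                           Γᵒ [ at-apex (precompose e M) m ≅ Γᵒ.id {apex B C (F₁ S′ m)} ]
      precompose-at-apex e M {m = m} = ∘-≡⇒Hom-id {C = Γᵒ} (apex-cong (eq₁ e m))

    -- Transport of a functor into the twist along a map of cospans.

    module _ (K : Functor Z (Γ ◇⟨ B ⋉ C ⟩)) {T : Functor Z Γᴮ}
             (M : CospanMap (π₂ ∘F K) T) where

      private
        el : ∀ z → Obj (Fib C (proj₁ (F₀ K z)))
        el z = proj₂ (F₀ K z)

        -- Applying `C` of the apex component gives a morphism with the wrong endpoints; the squares
        -- `at-lower` and `at-upper` identify them with the required ones.
        lift-over : ∀ {z z′} (m : Hom Z z z′) →
                    Hom (Fib C (apex B C (F₁ T m)))
                        (act C (lower B C (F₁ T m)) (act C (at M z) (el z)))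
                        (act C (upper B C (F₁ T m)) (act C (at M z′) (el z′)))
        lift-over {z} {z′} m =
          Cf.≡⇒Hom (act-square C (at-upper M m) (el z′))
            Cf.∘ F₁ (map C (at-apex M m)) (over (F₁ K m))
            Cf.∘ Cf.≡⇒Hom (sym (act-square C (at-lower M m) (el z)))

        lift-over-≅ : ∀ {z z′} (m : Hom Z z z′) →
                      Fib C ⟦ lift-over m ≅ F₁ (map C (at-apex M m)) (over (F₁ K m)) ⟧
        lift-over-≅ {z} {z′} m =
          ⟦ conjugate-≅ (act-square C (at-upper M m) (el z′)) _
                        (sym (act-square C (at-lower M m) (el z))) ⟧

      lift : Functor Z (Γ ◇⟨ B ⋉ C ⟩)
      F₀ lift z = F₀ T z , act C (at M z) (el z)
      F₁ lift m = F₁ T m , lift-over m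
      F-id lift {z} = ⋉-≡ B C (F-id T)
        (⟦trans⟧ (lift-over-≅ Z.id)
        -- `k` is `at-apex M Z.id` with its source moved to the apex of an identity. There `over` is
        -- a coercion, and `map C k` preserves coercions.
        (⟦trans⟧ (map-cong-≅ C (≅-sym (∘-≡⇒Hom (at-apex M Z.id) p)) (over-cong (F-id K)))
        (⟦trans⟧ ⟦ ≡⇒≅ (map-≡⇒Hom (map C k) (lower-upper-act B C (el z))) ⟧
                 -- The two coercions agree once their sources do, which is `at-lower` at the
                 -- identity.
                 (≡⇒Hom-⟦≅⟧ (cong (act C k) (lower-upper-act B C (el z)))
                            (lower-upper-act B C (act C (at M z) (el z)))
                   (act-square-≅ C
                     (≅-trans (absorb-≡⇒Hom (at-apex M Z.id) p
                                (lower-cong (≡⇒≅ (sym S-id))))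
                     (≅-trans (≡⇒≅ (at-lower M Z.id))
                              (∘-cong (lower-cong (≡⇒≅ (F-id T))) refl)))
                     (el z))))))
        where
        S-id = F-id (π₂ ∘F K) {z}
        p = cong (apex B C) (sym S-id)
        k = at-apex M Z.id Γᵒ.∘ Γᵒ.≡⇒Hom p
      F-∘ lift m′ m = ⋉-≡ B C (F-∘ T m′ m)
        (⟦trans⟧ (lift-over-≅ (m′ Z.∘ m))
        (⟦trans⟧ (map-cong-≅ C (≅-sym (∘-≡⇒Hom (at-apex M (m′ Z.∘ m)) p))
                   (⟦trans⟧ (over-cong (F-∘ K m′ m)) (⋉∘-over B C (F₁ K m′) (F₁ K m))))
        (⟦trans⟧ ⟦ ≡⇒≅ (glue-map (map C k) _ q _) ⟧
        -- `at-right` and `at-left` move the transport at the composite's apex inside `right` and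
        -- `left`, where it becomes the transport at the apices of `m′` and `m`.
        (⟦trans⟧ (glue-cong (cong (act C k) q) (middle B C (F₁ T m′) (F₁ T m) _)
                   (⟦trans⟧ (map-square C (commuting (at-right M m′ m p)) _)
                            (map-cong C refl (⟦sym⟧ (lift-over-≅ m′))))
                   (⟦trans⟧ (map-square C (commuting (at-left M m′ m p)) _)
                            (map-cong C refl (⟦sym⟧ (lift-over-≅ m)))))
                 (⟦sym⟧ (⋉∘-over B C (F₁ T m′ , lift-over m′) (F₁ T m , lift-over m)))))))
        where
        S = π₂ ∘F K
        p = apex-∘ S m′ m
        q = middle B C (F₁ S m′) (F₁ S m) (el _)
        k = at-apex M (m′ Z.∘ m) Γᵒ.∘ Γᵒ.≡⇒Hom p

      -- `C` preserves identities strictly, so the lift changes nothing where the components of `M`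
      -- are identities.
      lift-eq₀ : ∀ {z} → Γᵒ [ at M z ≅ Γᵒ.id {proj₁ (F₀ K z)} ] → F₀ lift z ≡ F₀ K z
      lift-eq₀ {z} e = act-≅-id C e (el z)

      lift-eq₁ : ∀ {z z′} (m : Hom Z z z′) →
                 Γᵒ [ at M z ≅ Γᵒ.id {proj₁ (F₀ K z)} ] →
                 Γᵒ [ at M z′ ≅ Γᵒ.id {proj₁ (F₀ K z′)} ] →
                 Γᵒ [ at-apex M m ≅ Γᵒ.id {apex B C (under (F₁ K m))} ] →
                 Γᴮ [ F₁ T m ≅ under (F₁ K m) ] →
                 (Γ ◇⟨ B ⋉ C ⟩) [ F₁ lift m ≅ F₁ K m ]
      lift-eq₁ m e e′ e″ u = ⋉-≅ (lift-eq₀ e) (lift-eq₀ e′) u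
        (⟦trans⟧ (lift-over-≅ m) (map-unit C e″ _))

-- Substitution under a context extension.

_↑_ : {Γ : Category o h} {Δ : Category o₁ h₁} (σ : Functor Δ Γ)
      (X : CatFunctor Γ o₂ h₂) → Functor (Δ ◇ X [ σ ]) (Γ ◇ X)
F₀ (σ ↑ X) (δ , x) = F₀ σ δ , x
F₁ (σ ↑ X) (k , ξ) = F₁ σ k , ξ
F-id (σ ↑ X) {_ , x} = ◇-≡ X (F-id σ)
  (≅-trans (≡⇒Hom-≅ʳ (eq₀ (map-id (X [ σ ])) x))
           (≅-sym (≡⇒Hom-≅ʳ (eq₀ (map-id X) x))))
F-∘ (σ ↑ X) {_ , x} (k′ , _) (k , _) = ◇-≡ X (F-∘ σ k′ k)
  (∘-cong refl (∘-cong refl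
    (≅-trans (≡⇒Hom-≅ʳ (eq₀ (map-∘ (X [ σ ]) k′ k) x))
             (≅-sym (≡⇒Hom-≅ʳ (eq₀ (map-∘ X (F₁ σ k′) (F₁ σ k)) x))))))

-- The squares from identity arrows.

module _ {Γ : Category o h} (A : CatFunctor Γ o₁ h₁) where
  private
    Δ = Γ ◇ A ^→
    module Γ = Category Γ
    module Δ = Category Δ
    module Af {γ} = Category (Fib A γ)
    σ = reflexivity A ∘F dom A

    ε-square : ∀ {γ} (f : ArrowObj (Fib A γ)) →
               Square (Fib A γ) (arrow (Af.id {x = ArrowObj.source f})) f
    ε-square f = square Af.id (ArrowObj.arr f) refl

  -- The counit of the adjunction in which `reflexivity A` is left adjoint to `dom A`, with identity
  -- unit. `dom-ε` and `ε-reflexivity` are its triangle identities.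
  ε : ∀ δ → Hom Δ (F₀ σ δ) δ
  ε (_ , f) = vertical (A ^→) (ε-square f)

  -- The top edges differ by identities only; the bottom edges agree because the square in `k`
  -- commutes.
  ε-natural : ∀ {δ δ′} (k : Hom Δ δ δ′) → ε δ′ Δ.∘ F₁ σ k ≡ k Δ.∘ ε δ
  ε-natural {_ , f} {_ , f′} k@(g , s) =
    ◇-≡ (A ^→) (trans (Γ.identityˡ g) (sym (Γ.identityʳ g)))
    (≅-trans (◇∘-fibre (A ^→) (ε (_ , f′)) (F₁ σ k))
    (≅-trans (∘-cong (vertical-fibre (A ^→) (ε-square f′)) (eq₁ (map-id (A ^→)) _))
    (≅-sym
    (≅-trans (◇∘-fibre (A ^→) k (ε (_ , f)))
    (≅-trans (∘-cong refl
               (Functor.F₁-cong (map (A ^→) g) (vertical-fibre (A ^→) (ε-square f))))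
             (≡⇒≅ (square-≡ _
               (trans (cong (top s Af.∘_) (F-id (map A g)))
                      (trans (Af.identityʳ _) (sym (Af.identityˡ _))))
               (commute s))))))))

  dom-ε : ∀ δ → F₁ (dom A) (ε δ) ≡ Category.id (Γ ◇ A)
  dom-ε (γ , f) = ◇-≡ A refl
    (≅-trans (≡⇒≅ (Af.identityˡ _))
    (≅-trans (source-≡⇒Hom A (eq₀ (map-id (A ^→)) _))
             (≅-sym (≡⇒Hom-≅ʳ (eq₀ (map-id A) (ArrowObj.source f))))))

  ε-reflexivity : ∀ s → ε (F₀ (reflexivity A) s) ≡ Δ.id
  ε-reflexivity (γ , a) = ◇-≡ (A ^→) refl
    (≅-trans (vertical-fibre (A ^→) (ε-square i))
    (≅-trans (≡⇒≅ (square-≡ (Fib A γ) refl refl))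
             (≅-sym (≡⇒Hom-≅ʳ (eq₀ (map-id (A ^→)) i)))))
    where i = arrow (Af.id {γ} {a})

  -- The squares over the context extended by `X`.

  module _ (X : CatFunctor (Γ ◇ A) o₂ h₂) where
    private
      B = X [ dom A ]
      Δᵒ = Δ ◇ B ^op
      module Δᵒ = Category Δᵒ
      module Bf {δ} = Category (Fib B δ)

    -- `B` is pulled back along `dom A`, which sends `ε` to an identity. Hence `x` can be kept fixed
    -- while the arrow varies.
    map-ε : ∀ δ → map B (ε δ) ≈ idF
    map-ε δ = map-≈ X (dom-ε δ) (map-id X)

    ε↑ : ∀ δ (x : Obj (Fib B δ)) → Hom Δᵒ (F₀ σ δ , x) (δ , x)
    ε↑ δ x = ε δ , Category.≡⇒Hom (op (Fib B δ)) (eq₀ (map-ε δ) x)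

    ε↑-cong : ∀ {δ} {x x′ : Obj (Fib B δ)} → x ≡ x′ → Δᵒ [ ε↑ δ x ≅ ε↑ δ x′ ]
    ε↑-cong refl = refl

    ε↑-fibre : ∀ δ x → op (Fib B δ) [ fibre (ε↑ δ x) ≅ Bf.id {δ} {x} ]
    ε↑-fibre δ x = ≡⇒Hom-≅ʳ {C = op (Fib B δ)} (eq₀ (map-ε δ) x)

    -- Naturality on the `upper` legs of cospans, from `map-ε`. The `lower` legs are treated next,
    -- where the base component is `ε-natural`.
    ε↑-vertical : ∀ δ {x x′} (ξ : Hom (op (Fib B δ)) x x′) →
                  ε↑ δ x′ Δᵒ.∘ vertical (B ^op) {F₀ σ δ} ξ
                  ≡ vertical (B ^op) {δ} ξ Δᵒ.∘ ε↑ δ x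
    ε↑-vertical δ {x} {x′} ξ =
      ◇-≡ (B ^op) (trans (Δ.identityʳ _) (sym (Δ.identityˡ _)))
      (≅-trans (◇∘-fibre (B ^op) (ε↑ δ x′) (vertical (B ^op) ξ))
      (≅-trans (∘-cong (ε↑-fibre δ x′)
                 (≅-trans (op-≅ (eq₁ (map-ε δ) _)) (vertical-fibre (B ^op) ξ)))
      (≅-trans (≡⇒≅ (trans (Bf.identityʳ {δ} ξ) (sym (Bf.identityˡ {δ} ξ))))
      (≅-sym
      (≅-trans (◇∘-fibre (B ^op) (vertical (B ^op) ξ) (ε↑ δ x))
               (∘-cong (vertical-fibre (B ^op) ξ)
                 (≅-trans (eq₁ (map-id (B ^op)) _) (ε↑-fibre δ x))))))))

    ε↑-cocartesian : ∀ {δ δ′} (k : Hom Δ δ δ′) x →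
                     ε↑ δ′ (act B k x) Δᵒ.∘ cocartesian (B ^op) (F₁ σ k) x
                     ≡ cocartesian (B ^op) k x Δᵒ.∘ ε↑ δ x
    ε↑-cocartesian {δ} {δ′} k x = ◇-≡ (B ^op) (ε-natural k)
      (≅-trans (◇∘-fibre (B ^op) (ε↑ δ′ (act B k x)) (cocartesian (B ^op) (F₁ σ k) x))
      (≅-trans (∘-cong (ε↑-fibre δ′ (act B k x)) (op-≅ (eq₁ (map-ε δ′) _)))
      (≅-sym
      (≅-trans (◇∘-fibre (B ^op) (cocartesian (B ^op) k x) (ε↑ δ x))
               (∘-cong refl
                 (≅-trans (Functor.F₁-cong (map (B ^op) k) (ε↑-fibre δ x))
                          (≡⇒≅ (F-id (map (B ^op) k)))))))))

    ε↑-reflexivity : ∀ s x → Δᵒ [ ε↑ (F₀ (reflexivity A) s) x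
                                ≅ Δᵒ.id {F₀ (reflexivity A) s , x} ]
    ε↑-reflexivity s x = ◇-≅ (B ^op) (ε-reflexivity s)
      (≅-trans (ε↑-fibre (F₀ (reflexivity A) s) x)
               (≅-sym (≡⇒Hom-≅ʳ {C = op (Fib B (F₀ (reflexivity A) s))} (eq₀ (map-id (B ^op)) x))))

    -- `y` is kept separate from `act B k x` because at the apex of a composite, transport along the
    -- composite equals iterated transport only propositionally.
    ε↑-left : ∀ {δ δ′} (k : Hom Δ δ δ′) {x y u} → y ≡ act B k x →
              (p : u ≡ (F₀ σ δ′ , y))
              {l : Hom Δᵒ (F₀ σ δ , x) u} {l′ : Hom Δᵒ (δ , x) (δ′ , y)} →
              Δᵒ [ l ≅ cocartesian (B ^op) (F₁ σ k) x ] →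
              Δᵒ [ l′ ≅ cocartesian (B ^op) k x ] →
              CommutesOver {C = Δᵒ} p l (ε↑ δ′ y) (ε↑ δ x) l′
    ε↑-left k {x} q p el el′ =
      replace-square {C = Δᵒ} (ε↑-cong q) el el′ (ε↑-cocartesian k x)

    ε↑-right : ∀ δ {x x′ y u} {ξ : Hom (op (Fib B δ)) x x′} → y ≡ x′ →
              (p : u ≡ (F₀ σ δ , y))
              {l : Hom Δᵒ (F₀ σ δ , x) u} {l′ : Hom Δᵒ (δ , x) (δ , y)} →
              Δᵒ [ l ≅ vertical (B ^op) {F₀ σ δ} ξ ] →
              Δᵒ [ l′ ≅ vertical (B ^op) {δ} ξ ] →
              CommutesOver {C = Δᵒ} p l (ε↑ δ y) (ε↑ δ x) l′
    ε↑-right δ {ξ = ξ} q p el el′ =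
      replace-square {C = Δᵒ} (ε↑-cong q) el el′ (ε↑-vertical δ ξ)

    module _ (D : CatFunctor (Δ ◇ B ^op) o₃ h₃) where

      -- The family `ε↑` also serves at apices, since the apex of `m` is again an object of
      -- `Δ ◇ B ^op`. The target is `idF`, so a lift along this map is a section of `π₂`.
      ε-cospan : CospanMap B D (r A X ∘F (dom A ↑ X)) idF
      CospanMap.at ε-cospan (δ , x) = ε↑ δ x
      CospanMap.at-apex ε-cospan {_ , x} {δ′ , _} m = ε↑ δ′ (act B (base m) x)
      CospanMap.at-lower ε-cospan {_ , x} m = ε↑-cocartesian (base m) x
      CospanMap.at-upper ε-cospan {_} {δ′ , _} m =
        ε↑-vertical δ′ (fibre m)
      CospanMap.at-left ε-cospan {_ , x} m′ m p =
        ε↑-left (base m′) (eq₀ (map-∘ B (base m′) (base m)) x) p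
          (left-≅-cocartesian B D (F₁ S m′) (F₁ S m)) (left-≅-cocartesian B D m′ m)
        where S = r A X ∘F (dom A ↑ X)
      CospanMap.at-right ε-cospan {_ , x} {_} {δ , _} m′ m p =
        ε↑-right δ (eq₀ (map-∘ B (base m′) (base m)) x) p
          (right-≅-vertical B D (F₁ S m′) (F₁ S m)) (right-≅-vertical B D m′ m)
        where S = r A X ∘F (dom A ↑ X)

-- The eliminator and its computation rule.

proposition32 : ∀ {o h o₁ h₁ o₂ h₂ o₃ h₃ : Level}
    (Γ : Category o h)
    (A : CatFunctor Γ o₁ h₁)
    (X : CatFunctor (Γ ◇ A) o₂ h₂)
    (D : CatFunctor (Γ ◇ A ^→ ◇ (X [ dom A ]) ^op) o₃ h₃)
    (d′ : Functor (Γ ◇ A ◇ X) ((Γ ◇ A ^→) ◇⟨ X [ dom A ] ⋉ D ⟩)) →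
    π₂ ∘F d′ ≈ r A X →
    Σ[ j ∈ Functor (Γ ◇ A ^→ ◇ X [ dom A ]) ((Γ ◇ A ^→) ◇⟨ X [ dom A ] ⋉ D ⟩) ]
    (π₂ ∘F j ≈ idF) × (j ∘F r A X ≈ d′)
proposition32 Γ A X D d′ e =
  lift B D K M ,
  -- The functor underlying `lift` is `idF` by definition.
  record { eq₀ = λ _ → refl ; eq₁ = λ _ → refl } ,
  -- `p ∘F r A X` fixes objects and morphisms definitionally, so `K` along `r A X` is already `d′`.
  record { eq₀ = λ z → lift-eq₀ B D K M (at-r≅id z)
         ; eq₁ = λ {z} {z′} m →
             lift-eq₁ B D K M (F₁ (r A X) m) (at-r≅id z) (at-r≅id z′)
               (at-apex-r≅id m) (≅-sym (eq₁ e m)) }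
  where
  B = X [ dom A ]
  Δᵒ = (Γ ◇ A ^→) ◇ B ^op
  p = dom A ↑ X
  K = d′ ∘F p

  e↑ : π₂ ∘F K ≈ r A X ∘F p
  eq₀ e↑ z = eq₀ e (F₀ p z)
  eq₁ e↑ m = eq₁ e (F₁ p m)

  N : CospanMap B D (r A X ∘F p) idF
  N = ε-cospan A X D

  M : CospanMap B D (π₂ ∘F K) idF
  M = precompose B D e↑ N

  at-r≅id : ∀ z → Δᵒ [ CospanMap.at M (F₀ (r A X) z) ≅ Category.id Δᵒ {proj₁ (F₀ d′ z)} ]
  at-r≅id z@(s , x) = precompose-at B D e↑ N {F₀ (r A X) z} (ε↑-reflexivity A X s x)

  at-apex-r≅id : ∀ {z z′} (m : Hom (Γ ◇ A ◇ X) z z′) →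
                 Δᵒ [ CospanMap.at-apex M (F₁ (r A X) m)
                    ≅ Category.id Δᵒ {apex B D (under (F₁ d′ m))} ]
  at-apex-r≅id {_ , x} {s′ , _} m =
    precompose-at-apex B D e↑ N {m = F₁ (r A X) m}
      -- The apex of `F₁ (r A X) m` lies over the identity arrow at the codomain of `m`, so its
      -- component is an identity too.
      (ε↑-reflexivity A X s′ (act X (base m) x))
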